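{- Let $(C,e,\lambda,\oplus)$ be the free Catalan structure, and let $h,\mathrm{rev},\mathrm{corev}\colon C\to C$ be the maps defined in the context. Then $h=\mathrm{rev}\circ\mathrm{corev}\circ\mathrm{rev}$.
   Context: A Catalan structure is a quadruple $(C,e,\lambda,\oplus)$ where $C=\bigsqcup_{n\ge 0}C_n$ with $C_0=\{e\}$ ($|t|=n$ for $t\in C_n$), $\lambda\colon C_n\to C_{n+1}$, $\oplus\colon C_m\times C_n\to C_{m+n}$, $\oplus$ is associative with two-sided identity $e$, and every $t\in C$ can be written uniquely in exactly one of three forms: $t=e$; $t=\lambda(s)$ with $s\in C$ (indecomposable); $t=u\oplus v$ with $u$ indecomposable and $v\in C\setminus C_0$ (decomposable). Hence every nonempty $t$ is uniquely $\lambda(u)\oplus v$ ($v=e$ allowed). The free Catalan structure is realized by the formal expressions $e$, $\lambda(t)$, $\lambda(u)\oplus v$ with $v\ne e$; it is isomorphic to rooted plane trees written as lists of children, with $e=[\,]$, $\lambda(T)=[T]$, $\oplus$ = concatenation of child lists. Put $\gamma(t)=t\oplus\lambda(e)$ and define $\ominus$ by $e\ominus v=v$, $\lambda(u)\ominus v=\lambda(u\ominus v)$, $(t\oplus u)\ominus v=t\oplus(u\ominus v)$ for $t,u\ne e$ (well defined; one may take $t$ indecomposable). The maps (with $u,v\in C$ arbitrary, $v=e$ allowed): $h(e)=e$, $h(\lambda(u)\oplus v)=h(v)\ominus\gamma(h(u))$; $\mathrm{rev}(e)=e$, $\mathrm{rev}(\lambda(u)\oplus v)=\mathrm{rev}(v)\oplus\lambda(\mathrm{rev}(u))$;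 $\mathrm{corev}(e)=e$, $\mathrm{corev}(\lambda(u)\oplus v)=\lambda(\mathrm{corev}(v))\oplus\mathrm{corev}(u)$. -}

module Defs where

open import Data.Nat.Base using (ℕ; suc; _+_)
open import Data.Nat.Properties using (+-assoc; +-identityʳ)
open import Data.Product.Base using (∃-syntax; _×_; _,_)
open import Data.Sum.Base using (_⊎_; inj₁; inj₂)
open import Level using (Level) renaming (suc to lsuc)
open import Relation.Binary.PropositionalEquality
  using (_≡_; _≢_; _≗_; refl; sym; trans; cong; cong₂)
open import Relation.Nullary using (contradiction)

-- The grading C = ⨆ Cₙ is given by the size map, with t ∈ Cₙ meaning ∣ t ∣ ≡ n.
record CatalanStructure (ℓ : Level) : Set (lsuc ℓ) where
  infixr 6 _⊕_
  field
    Carrier : Set ℓ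
    ∣_∣     : Carrier → ℕ
    e       : Carrier
    ƛ       : Carrier → Carrier
    _⊕_     : Carrier → Carrier → Carrier

  Indecomposable : Carrier → Set ℓ
  Indecomposable t = ∃[ s ] t ≡ ƛ s

  field
    ∣e∣       : ∣ e ∣ ≡ 0
    ∣t∣≡0⇒t≡e : ∀ t → ∣ t ∣ ≡ 0 → t ≡ e
    ∣ƛ∣       : ∀ t → ∣ ƛ t ∣ ≡ suc ∣ t ∣
    ∣⊕∣       : ∀ u v → ∣ u ⊕ v ∣ ≡ ∣ u ∣ + ∣ v ∣
    ⊕-assoc     : ∀ t u v → (t ⊕ u) ⊕ v ≡ t ⊕ (u ⊕ v)
    ⊕-identityˡ : ∀ t → e ⊕ t ≡ t
    ⊕-identityʳ : ∀ t → t ⊕ e ≡ t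
    form : ∀ t → t ≡ e ⊎ Indecomposable t ⊎
                 ∃[ u ] ∃[ v ] (Indecomposable u × v ≢ e × t ≡ u ⊕ v)
    e≢ƛ : ∀ s → e ≢ ƛ s
    e≢⊕ : ∀ {u v} → Indecomposable u → v ≢ e → e ≢ u ⊕ v
    ƛ≢⊕ : ∀ {s u v} → Indecomposable u → v ≢ e → ƛ s ≢ u ⊕ v
    ƛ-injective : ∀ {s s′} → ƛ s ≡ ƛ s′ → s ≡ s′
    ⊕-injective : ∀ {u u′ v v′} → Indecomposable u → v ≢ e →
                  Indecomposable u′ → v′ ≢ e →
                  u ⊕ v ≡ u′ ⊕ v′ → u ≡ u′ × v ≡ v′

-- The free Catalan structure.  u ◂ v stands for λ(u) ⊕ v with v = e allowed,
-- so the formal expression λ(t) is t ◂ e; as a plane tree given by its list of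
-- children, u ◂ v has first child u and the children of v as remaining ones.
infixr 6 _◂_ _⊕_
infixl 6 _⊖_

data C : Set where
  e   : C
  _◂_ : C → C → C

∣_∣ : C → ℕ
∣ e ∣     = 0
∣ u ◂ v ∣ = suc (∣ u ∣ + ∣ v ∣)

ƛ : C → C
ƛ t = t ◂ e

_⊕_ : C → C → C
e       ⊕ w = w
(u ◂ v) ⊕ w = u ◂ (v ⊕ w)

γ : C → C
γ t = t ⊕ ƛ e

-- The last clause takes the first summand of t ⊕ u indecomposable;
-- ⊖-⊕ below gives the rule for an arbitrary first summand.
_⊖_ : C → C → C
e               ⊖ w = w
(u ◂ e)         ⊖ w = ƛ (u ⊖ w)
(u ◂ v@(_ ◂ _)) ⊖ w = ƛ u ⊕ (v ⊖ w)

h : C → C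
h e       = e
h (u ◂ v) = h v ⊖ γ (h u)

rev : C → C
rev e       = e
rev (u ◂ v) = rev v ⊕ ƛ (rev u)

corev : C → C
corev e       = e
corev (u ◂ v) = ƛ (corev v) ⊕ corev u

⊖-⊕ : ∀ t u w → t ≢ e → u ≢ e → (t ⊕ u) ⊖ w ≡ t ⊕ (u ⊖ w)
⊖-⊕ e               u         w t≢e u≢e = contradiction refl t≢e
⊖-⊕ (_ ◂ _)         e         w t≢e u≢e = contradiction refl u≢e
⊖-⊕ (a ◂ e)         (_ ◂ _)   w t≢e u≢e = refl
⊖-⊕ (a ◂ b@(_ ◂ _)) u@(_ ◂ _) w t≢e u≢e = cong (a ◂_) (⊖-⊕ b u w (λ ()) u≢e)

free : CatalanStructure _
free = record
  { Carrier = C ; ∣_∣ = ∣_∣ ; e = e ; ƛ = ƛ ; _⊕_ = _⊕_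
  ; ∣e∣ = refl
  ; ∣t∣≡0⇒t≡e = λ { e _ → refl }
  ; ∣ƛ∣ = λ t → cong suc (+-identityʳ (∣ t ∣))
  ; ∣⊕∣ = size
  ; ⊕-assoc = assoc
  ; ⊕-identityˡ = λ _ → refl
  ; ⊕-identityʳ = identityʳ
  ; form = λ { e → inj₁ refl
             ; (u ◂ e) → inj₂ (inj₁ (u , refl))
             ; (u ◂ v@(_ ◂ _)) → inj₂ (inj₂ (ƛ u , v , (u , refl) , (λ ()) , refl)) }
  ; e≢ƛ = λ _ ()
  ; e≢⊕ = λ { (_ , refl) _ () }
  ; ƛ≢⊕ = λ { (_ , refl) v≢e refl → v≢e refl }
  ; ƛ-injective = λ { refl → refl }
  ; ⊕-injective = λ { (_ , refl) _ (_ , refl) _ refl → refl , refl }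
  }
  where
  size : ∀ u v → ∣ u ⊕ v ∣ ≡ ∣ u ∣ + ∣ v ∣
  size e       w = refl
  size (u ◂ v) w = cong suc (trans (cong (∣ u ∣ +_) (size v w))
                                   (sym (+-assoc (∣ u ∣) (∣ v ∣) (∣ w ∣))))

  assoc : ∀ t u v → (t ⊕ u) ⊕ v ≡ t ⊕ (u ⊕ v)
  assoc e       u v = refl
  assoc (a ◂ b) u v = cong (a ◂_) (assoc b u v)

  identityʳ : ∀ t → t ⊕ e ≡ t
  identityʳ e       = refl
  identityʳ (a ◂ b) = cong (a ◂_) (identityʳ b)

module _ {ℓ} (S : CatalanStructure ℓ) where
  private module S = CatalanStructure S

  record IsHomomorphism (f : C → S.Carrier) : Set ℓ where
    field
      f-e : f e ≡ S.e
      f-ƛ : ∀ t → f (ƛ t) ≡ S.ƛ (f t)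
      f-⊕ : ∀ u v → f (u ⊕ v) ≡ f u S.⊕ f v

  fold : C → S.Carrier
  fold e       = S.e
  fold (u ◂ v) = S.ƛ (fold u) S.⊕ fold v

  fold-isHomomorphism : IsHomomorphism fold
  fold-isHomomorphism = record
    { f-e = refl ; f-ƛ = λ _ → S.⊕-identityʳ _ ; f-⊕ = pres }
    where
    pres : ∀ u v → fold (u ⊕ v) ≡ fold u S.⊕ fold v
    pres e       w = sym (S.⊕-identityˡ _)
    pres (u ◂ v) w = trans (cong (S.ƛ (fold u) S.⊕_) (pres v w))
                           (sym (S.⊕-assoc _ _ _))

  fold-unique : ∀ {f} → IsHomomorphism f → f ≗ fold
  fold-unique F e       = IsHomomorphism.f-e F
  fold-unique F (u ◂ v) =
    trans (f-⊕ (ƛ u) v)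
          (cong₂ S._⊕_ (trans (f-ƛ u) (cong S.ƛ (fold-unique F u))) (fold-unique F v))
    where open IsHomomorphism F

{-# OPTIONS --safe #-}
module Submission where

open import Function.Base using (_∘_)
open import Relation.Binary.PropositionalEquality
  using (_≡_; _≗_; refl; cong; cong₂; module ≡-Reasoning)
open import Defs

-- The composite rev ∘ corev turns ⊕ into ⊖ and λ into γ ∘ rev ∘ corev.  Applied
-- to rev (λ(u) ⊕ v) = rev v ⊕ λ(rev u), it yields the recursion defining h.

open ≡-Reasoning

-- `⊖` descends into the last child only. Here `t` may be `e`, as `rev (corev u)` can be.
⊕ƛ-⊖ : ∀ t u w → (t ⊕ ƛ u) ⊖ w ≡ t ⊕ ƛ (u ⊖ w)
⊕ƛ-⊖ e         u w = refl
⊕ƛ-⊖ t@(_ ◂ _) u w = ⊖-⊕ t (ƛ u) w (λ ()) (λ ())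

-- In `u ◂ v`, `corev` moves the tail `v` under the first `ƛ`, and `rev` makes that the last child.
-- So the end of the child list becomes the end of the rightmost branch, where `⊖` grafts.
rev-corev-⊕ : ∀ t w → rev (corev (t ⊕ w)) ≡ rev (corev t) ⊖ rev (corev w)
rev-corev-⊕ e       w = refl
rev-corev-⊕ (u ◂ v) w = begin
  rev (corev u) ⊕ ƛ (rev (corev (v ⊕ w)))
    ≡⟨ cong (λ x → rev (corev u) ⊕ ƛ x) (rev-corev-⊕ v w) ⟩
  rev (corev u) ⊕ ƛ (rev (corev v) ⊖ rev (corev w))
    ≡⟨ ⊕ƛ-⊖ (rev (corev u)) (rev (corev v)) (rev (corev w)) ⟨
  (rev (corev u) ⊕ ƛ (rev (corev v))) ⊖ rev (corev w) ∎

theorem5p3 : h ≗ rev ∘ corev ∘ rev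
theorem5p3 e       = refl
theorem5p3 (u ◂ v) = begin
  h v ⊖ γ (h u)
    ≡⟨ cong₂ (λ x y → x ⊖ γ y) (theorem5p3 v) (theorem5p3 u) ⟩
  rev (corev (rev v)) ⊖ γ (rev (corev (rev u)))
    -- By computation `corev (ƛ x)` is `e ◂ corev x`, which `rev` sends to `γ (rev (corev x))`.
    ≡⟨ rev-corev-⊕ (rev v) (ƛ (rev u)) ⟨
  rev (corev (rev v ⊕ ƛ (rev u))) ∎
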